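{- Let $k\ge d\ge 3$ and $t\ge 2$ be fixed integers. Then \[ g(n,k,d,t)=f(n,k,d,1) \] holds for all sufficiently large $n$ (depending on $k,d,t$).
   Context: $[n]=\{1,\dots,n\}$, and $\binom{V}{k}$ is the collection of all $k$-element subsets of a set $V$. A $d$-cluster of $k$-sets is a collection of $d$ different $k$-sets $A_1,\dots,A_d$ with $|A_1\cup\dots\cup A_d|\le 2k$ and $A_1\cap\dots\cap A_d=\emptyset$. A family $\mathcal{F}\subset\binom{[n]}{k}$ is $d$-cluster-free if it contains no $d$-cluster. The matching number $\nu(\mathcal{F})$ is the maximum number of pairwise disjoint sets in $\mathcal{F}$. $f(n,k,d,1)$ is the maximum size of a $d$-cluster-free family $\mathcal{F}\subset\binom{[n]}{k}$ with matching number at least $2$ (i.e. $\mathcal{F}$ is not intersecting). $g(n,k,d,t)$ is the maximum size of a family $\mathcal{F}\subset\binom{[n]}{k}$ that is $d$-cluster-free but not $t$-wise intersecting, i.e. for all distinct $A_1,\dots,A_d\in\mathcal{F}$ we have $A_1\cap\dots\cap A_d\ne\emptyset$ whenever $|A_1\cup\dots\cup A_d|\le 2k$, but there exist sets $A'_1,\dots,A'_t\in\mathcal{F}$ with $A'_1\cap\dots\cap A'_t=\emptyset$. -}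

module Defs where

open import Data.Fin.Subset using (Subset; Empty; _∩_; ⋃; ⋂; ∣_∣)
open import Data.List.Base using (List; length)
open import Data.List.Membership.Propositional using (_∈_)
open import Data.List.Relation.Binary.Subset.Propositional using (_⊆_)
open import Data.List.Relation.Unary.All using (All)
open import Data.List.Relation.Unary.AllPairs using (AllPairs)
open import Data.List.Relation.Unary.Unique.Propositional using (Unique)
open import Data.Nat.Base using (ℕ; _*_; _≤_; _<_)
open import Data.Product.Base using (∃; _×_)
open import Data.Vec.Base using (Vec; toList)
open import Relation.Binary.PropositionalEquality.Core using (_≡_)
open import Relation.Nullary.Negation.Core using (¬_)

-- A family of k-element subsets of [n] = Fin n.  The enumeration has no
-- repetitions, so its length is the cardinality of the family; the order in
-- which the members are listed is irrelevant to everything below.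
record Family (n k : ℕ) : Set where
  field
    members  : List (Subset n)
    distinct : Unique members
    uniform  : All (λ A → ∣ A ∣ ≡ k) members

  size : ℕ
  size = length members

open Family public

_⊆ᶠ_ : ∀ {n k} → Family n k → Family n k → Set
G ⊆ᶠ F = members G ⊆ members F

IsMaximum : (ℕ → Set) → ℕ → Set
IsMaximum P m = P m × (∀ m′ → P m′ → m′ ≤ m)

IsMaxSize : ∀ {n k} → (Family n k → Set) → ℕ → Set
IsMaxSize P = IsMaximum (λ m → ∃ λ F → P F × size F ≡ m)

IsCluster : ∀ {n k} → ℕ → Family n k → Set
IsCluster {k = k} d C =
  size C ≡ d × ∣ ⋃ (members C) ∣ ≤ 2 * k × Empty (⋂ (members C))

ClusterFree : ∀ {n k} → ℕ → Family n k → Set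
ClusterFree d F = ∀ C → C ⊆ᶠ F → ¬ IsCluster d C

PairwiseDisjoint : ∀ {n k} → Family n k → Set
PairwiseDisjoint M = AllPairs (λ A B → Empty (A ∩ B)) (members M)

IsMatchingNumber : ∀ {n k} → Family n k → ℕ → Set
IsMatchingNumber F = IsMaxSize (λ M → M ⊆ᶠ F × PairwiseDisjoint M)

-- F is not t-wise intersecting.  The sets A₁, …, Aₜ may repeat, unlike those
-- of a cluster.
NotWiseIntersecting : ∀ {n k} → ℕ → Family n k → Set
NotWiseIntersecting {n} t F =
  ∃ λ (As : Vec (Subset n) t) →
    All (_∈ members F) (toList As) × Empty (⋂ (toList As))

-- "f(n,k,d,s) = m": m is the maximum size of a d-cluster-free family of
-- k-subsets of [n] whose matching number is at least s + 1.
f⟨_,_,_,_⟩≔_ : ℕ → ℕ → ℕ → ℕ → ℕ → Set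
f⟨ n , k , d , s ⟩≔ m =
  IsMaxSize {n} {k}
    (λ F → ClusterFree d F × ∃ λ ν → IsMatchingNumber F ν × s < ν) m

-- "g(n,k,d,t) = m".
g⟨_,_,_,_⟩≔_ : ℕ → ℕ → ℕ → ℕ → ℕ → Set
g⟨ n , k , d , t ⟩≔ m =
  IsMaxSize {n} {k} (λ F → ClusterFree d F × NotWiseIntersecting t F) m

{-# OPTIONS --safe #-}

-- A family that is not pairwise intersecting is not t-wise intersecting either,
-- as the vectors of sets may repeat a member.  Conversely, if the members
-- pairwise meet but A₁ ∩ … ∩ Aₜ = ∅, then every member contains one of the
-- ∣A₁∣ elements x of A₁ and, as some Aⱼ misses x, also an element of this Aⱼ
-- other than x; so there are at most k² C(n,k−2) members.  For large n this is
-- less than C(n−k−1,k−1), hence less than the size of the cluster-free family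
-- consisting of a set B and of all sets disjoint from B through a fixed point.
module Submission where

open import Defs
open import Data.Bool.Properties using () renaming (_≟_ to _≟ᵇ_)
open import Data.Fin.Base using (Fin; zero; suc)
open import Data.Fin.Subset
open import Data.Fin.Subset.Properties
open import Data.List.Base using (List; []; _∷_; _++_; map; length; concatMap)
open import Data.List.Membership.DecPropositional using () renaming (_∈?_ to ∈ˡ-dec)
open import Data.List.Membership.Propositional using (find; lose) renaming (_∈_ to _∈ˡ_)
open import Data.List.Membership.Propositional.Properties
  using (∈-∃++; ∈-++⁺ˡ; ∈-++⁺ʳ; ∈-++⁻; ∈-map⁺; ∈-map⁻; ∈-concatMap⁺)
open import Data.List.Properties using (length-++; length-++-sucʳ; length-map)
open import Data.List.Relation.Binary.Subset.DecPropositional using () renaming (_⊆?_ to ⊆ˡ-dec)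
open import Data.List.Relation.Binary.Subset.Propositional
  using () renaming (_⊆_ to _⊆ˡ_)
open import Data.List.Relation.Unary.All as All using (All; []; _∷_)
open import Data.List.Relation.Unary.All.Properties using (¬All⇒Any¬)
  renaming (map⁺ to All-map⁺; ++⁺ to All-++⁺)
open import Data.List.Relation.Unary.AllPairs as AllPairs using (AllPairs; []; _∷_)
open import Data.List.Relation.Unary.Any as Any using (Any; here; there)
open import Data.List.Relation.Unary.Unique.DecPropositional using (unique?)
open import Data.List.Relation.Unary.Unique.Propositional using (Unique)
import Data.List.Relation.Unary.Unique.Propositional.Properties as Unique
open import Data.Nat.Base
open import Data.Nat.Combinatorics using (_C_; nCk+nC[k+1]≡[n+1]C[k+1])
open import Data.Nat.DivMod using (m/n*n≤m; m*n/n≡m; m%n<n; m≡m%n+[m/n]*n; /-monoˡ-≤)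
open import Data.Nat.Properties renaming (_≟_ to _≟ⁿ_)
open import Data.Product.Base using (∃; _×_; _,_; proj₁; proj₂)
open import Data.Sum.Base using (inj₁; inj₂)
open import Data.Vec.Base as Vec using (Vec; []; _∷_; toList; fromList; replicate; lookup; _[_]≔_)
open import Data.Vec.Properties
  using (toList∘fromList; length-toList; ≡-dec; []≔-idempotent; []≔-lookup; []≔-minimal;
         []=⇒lookup; ∷-injectiveʳ; ++-injectiveʳ)
open import Function.Base using (_∘_; case_of_)
open import Relation.Binary.Definitions using (DecidableEquality)
open import Relation.Binary.PropositionalEquality
open import Relation.Nullary.Decidable
  using (Dec; yes; no; ¬?; map′; _×-dec_; decidable-stable)
open import Relation.Nullary.Negation using (¬_; contradiction)
open import Relation.Unary using (Decidable)

private
  variable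
    n k d t : ℕ

_≟_ : DecidableEquality (Subset n)
_≟_ = ≡-dec _≟ᵇ_

-- Counting with duplicate-free lists

Unique-⊆⇒length≤ : ∀ {A : Set} {xs ys : List A} → Unique xs → xs ⊆ˡ ys → length xs ≤ length ys
Unique-⊆⇒length≤ []            xs⊆ys = z≤n
Unique-⊆⇒length≤ {xs = x ∷ xs} (x∉xs ∷ xs!) xs⊆ys with ∈-∃++ (xs⊆ys (here refl))
... | as , bs , refl = begin
  suc (length xs)         ≤⟨ s≤s (Unique-⊆⇒length≤ xs! xs⊆as++bs) ⟩
  suc (length (as ++ bs)) ≡⟨ length-++-sucʳ as x bs ⟨
  length (as ++ x ∷ bs)   ∎
  where
  open ≤-Reasoning
  xs⊆as++bs : xs ⊆ˡ as ++ bs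
  xs⊆as++bs y∈xs with ∈-++⁻ as (xs⊆ys (there y∈xs))
  ... | inj₁ y∈as          = ∈-++⁺ˡ y∈as
  ... | inj₂ (here refl)   = contradiction refl (All.lookup x∉xs y∈xs)
  ... | inj₂ (there y∈bs)  = ∈-++⁺ʳ as y∈bs

length-concatMap-≤ : ∀ {A B : Set} (f : A → List B) {c} → (∀ x → length (f x) ≤ c) →
                     ∀ xs → length (concatMap f xs) ≤ length xs * c
length-concatMap-≤ f f≤c []       = z≤n
length-concatMap-≤ f f≤c (x ∷ xs) = begin
  length (f x ++ concatMap f xs)          ≡⟨ length-++ (f x) ⟩
  length (f x) + length (concatMap f xs)  ≤⟨ +-mono-≤ (f≤c x) (length-concatMap-≤ f f≤c xs) ⟩
  _                                       ∎
  where open ≤-Reasoning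

-- Meant for a cluster that contains an exceptional set `b`: since `d` is at least 3, two further
-- members of the cluster are available.
two-others : ∀ {A : Set} → DecidableEquality A → ∀ (b : A) {xs} → Unique xs → 3 ≤ length xs →
             ∃ λ x → ∃ λ y → (x ∈ˡ xs × x ≢ b) × (y ∈ˡ xs × y ≢ b) × x ≢ y
two-others _≟_ b {x ∷ []}         _ (s≤s ())
two-others _≟_ b {x ∷ y ∷ []}     _ (s≤s (s≤s ()))
two-others _≟_ b {x ∷ y ∷ z ∷ _} ((x≢y ∷ x≢z ∷ _) ∷ (y≢z ∷ _) ∷ _) _ with x ≟ b | y ≟ b
... | yes refl | _        =
  y , z , (there (here refl) , ≢-sym x≢y) , (there (there (here refl)) , ≢-sym x≢z) , y≢z
... | no x≢b   | yes refl =
  x , z , (here refl , x≢b) , (there (there (here refl)) , ≢-sym y≢z) , x≢z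
... | no x≢b   | no y≢b   = x , y , (here refl , x≢b) , (there (here refl) , y≢b) , x≢y

-- Cardinalities

∣p++q∣≡∣p∣+∣q∣ : ∀ {m} (p : Subset m) (q : Subset n) → ∣ p Vec.++ q ∣ ≡ ∣ p ∣ + ∣ q ∣
∣p++q∣≡∣p∣+∣q∣ []            q = refl
∣p++q∣≡∣p∣+∣q∣ (inside  ∷ p) q = cong suc (∣p++q∣≡∣p∣+∣q∣ p q)
∣p++q∣≡∣p∣+∣q∣ (outside ∷ p) q = ∣p++q∣≡∣p∣+∣q∣ p q

Empty[p∩q]⇒∣p∪q∣≡∣p∣+∣q∣ : ∀ (p q : Subset n) → Empty (p ∩ q) → ∣ p ∪ q ∣ ≡ ∣ p ∣ + ∣ q ∣
Empty[p∩q]⇒∣p∪q∣≡∣p∣+∣q∣ []            []            _ = refl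
Empty[p∩q]⇒∣p∪q∣≡∣p∣+∣q∣ (inside  ∷ p) (inside  ∷ q) e = contradiction (zero , Vec.here) e
Empty[p∩q]⇒∣p∪q∣≡∣p∣+∣q∣ (inside  ∷ p) (outside ∷ q) e =
  cong suc (Empty[p∩q]⇒∣p∪q∣≡∣p∣+∣q∣ p q (drop-∷-Empty e))
Empty[p∩q]⇒∣p∪q∣≡∣p∣+∣q∣ (outside ∷ p) (inside  ∷ q) e =
  trans (cong suc (Empty[p∩q]⇒∣p∪q∣≡∣p∣+∣q∣ p q (drop-∷-Empty e))) (sym (+-suc ∣ p ∣ ∣ q ∣))
Empty[p∩q]⇒∣p∪q∣≡∣p∣+∣q∣ (outside ∷ p) (outside ∷ q) e =
  Empty[p∩q]⇒∣p∪q∣≡∣p∣+∣q∣ p q (drop-∷-Empty e)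

p⊆q∧∣q∣≤∣p∣⇒p≡q : ∀ {p q : Subset n} → p ⊆ q → ∣ q ∣ ≤ ∣ p ∣ → p ≡ q
p⊆q∧∣q∣≤∣p∣⇒p≡q {p = p} p⊆q ∣q∣≤∣p∣ = ⊆-antisym p⊆q λ {x} x∈q →
  decidable-stable (x ∈? p) λ x∉p →
    contradiction (p⊂q⇒∣p∣<∣q∣ (p⊆q , x , x∈q , x∉p)) (≤⇒≯ ∣q∣≤∣p∣)

-- If the union were no larger than `p`, it would coincide with `p`, and with `q` for the same
-- reason. The strict inequality later pushes a union above 2k.
∣p∣≡∣q∣∧p≢q⇒∣p∣<∣p∪q∣ : ∀ {p q : Subset n} → ∣ p ∣ ≡ ∣ q ∣ → p ≢ q → ∣ p ∣ < ∣ p ∪ q ∣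
∣p∣≡∣q∣∧p≢q⇒∣p∣<∣p∪q∣ {p = p} {q} ∣p∣≡∣q∣ p≢q = ≰⇒> λ ∣p∪q∣≤∣p∣ → p≢q (trans
  (p⊆q∧∣q∣≤∣p∣⇒p≡q (p⊆p∪q q) ∣p∪q∣≤∣p∣)
  (sym (p⊆q∧∣q∣≤∣p∣⇒p≡q (q⊆p∪q p q) (subst (∣ p ∪ q ∣ ≤_) ∣p∣≡∣q∣ ∣p∪q∣≤∣p∣))))

p∈ps⇒p⊆⋃ps : ∀ {p} {ps : List (Subset n)} → p ∈ˡ ps → p ⊆ ⋃ ps
p∈ps⇒p⊆⋃ps {ps = p ∷ ps} (here refl)   = p⊆p∪q (⋃ ps)
p∈ps⇒p⊆⋃ps {ps = q ∷ ps} (there p∈ps) = q⊆p∪q q (⋃ ps) ∘ p∈ps⇒p⊆⋃ps p∈ps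

All∈⇒∈⋂ : ∀ {x} {ps : List (Subset n)} → All (x ∈_) ps → x ∈ ⋂ ps
All∈⇒∈⋂ []             = ∈⊤
All∈⇒∈⋂ (x∈p ∷ x∈ps) = x∈p∩q⁺ (x∈p , All∈⇒∈⋂ x∈ps)

Empty⋂⇒∃∌ : ∀ (ps : List (Subset n)) → Empty (⋂ ps) → ∀ x → ∃ λ p → p ∈ˡ ps × x ∉ p
Empty⋂⇒∃∌ ps e x = find (¬All⇒Any¬ (x ∈?_) ps λ all∋x → e (x , All∈⇒∈⋂ all∋x))

-- Enumerations of subsets

elements : Subset n → List (Fin n)
elements []            = []
elements (inside  ∷ p) = zero ∷ map suc (elements p)
elements (outside ∷ p) = map suc (elements p)

length-elements : ∀ (p : Subset n) → length (elements p) ≡ ∣ p ∣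
length-elements []            = refl
length-elements (inside  ∷ p) = cong suc (trans (length-map suc (elements p)) (length-elements p))
length-elements (outside ∷ p) = trans (length-map suc (elements p)) (length-elements p)

∈-elements : ∀ {x} {p : Subset n} → x ∈ p → x ∈ˡ elements p
∈-elements Vec.here                            = here refl
∈-elements {p = inside  ∷ p} (Vec.there x∈p) = there (∈-map⁺ suc (∈-elements x∈p))
∈-elements {p = outside ∷ p} (Vec.there x∈p) = ∈-map⁺ suc (∈-elements x∈p)

-- The recursion splits on whether the first point is included, just as Pascal's rule does, so the
-- length is a binomial coefficient by the same induction.
subsetsOfSize : ∀ n → ℕ → List (Subset n)
subsetsOfSize n       zero    = ⊥ ∷ []
subsetsOfSize zero    (suc k) = []
subsetsOfSize (suc n) (suc k) =
  map (inside ∷_) (subsetsOfSize n k) ++ map (outside ∷_) (subsetsOfSize n (suc k))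

length-subsetsOfSize : ∀ n k → length (subsetsOfSize n k) ≡ n C k
length-subsetsOfSize n       zero    = refl
length-subsetsOfSize zero    (suc k) = refl
length-subsetsOfSize (suc n) (suc k) = begin
  length (map (inside ∷_) (subsetsOfSize n k) ++ map (outside ∷_) (subsetsOfSize n (suc k)))
    ≡⟨ length-++ (map (inside ∷_) (subsetsOfSize n k)) ⟩
  length (map (inside ∷_) (subsetsOfSize n k)) + length (map (outside ∷_) (subsetsOfSize n (suc k)))
    ≡⟨ cong₂ _+_ (trans (length-map _ (subsetsOfSize n k)) (length-subsetsOfSize n k))
                 (trans (length-map _ (subsetsOfSize n (suc k))) (length-subsetsOfSize n (suc k))) ⟩
  n C k + n C suc k
    ≡⟨ nCk+nC[k+1]≡[n+1]C[k+1] n k ⟩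
  suc n C suc k ∎
  where open ≡-Reasoning

∈-subsetsOfSize⁺ : ∀ (p : Subset n) → ∣ p ∣ ≡ k → p ∈ˡ subsetsOfSize n k
∈-subsetsOfSize⁺ {k = zero}  p             ∣p∣≡0 =
  here (Empty-unique λ (x , x∈p) →
    contradiction (m<n⇒0<n (x∈p⇒∣p-x∣<∣p∣ x∈p)) (≤⇒≯ (≤-reflexive ∣p∣≡0)))
∈-subsetsOfSize⁺ {k = suc k} (inside  ∷ p) ∣p∣≡k =
  ∈-++⁺ˡ (∈-map⁺ (inside ∷_) (∈-subsetsOfSize⁺ p (suc-injective ∣p∣≡k)))
∈-subsetsOfSize⁺ {n = suc n} {k = suc k} (outside ∷ p) ∣p∣≡k =
  ∈-++⁺ʳ (map (inside ∷_) (subsetsOfSize n k)) (∈-map⁺ (outside ∷_) (∈-subsetsOfSize⁺ p ∣p∣≡k))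

subsetsOfSize-uniform : ∀ n k → All (λ p → ∣ p ∣ ≡ k) (subsetsOfSize n k)
subsetsOfSize-uniform n       zero    = ∣⊥∣≡0 n ∷ []
subsetsOfSize-uniform zero    (suc k) = []
subsetsOfSize-uniform (suc n) (suc k) = All-++⁺
  (All-map⁺ (All.map (cong suc) (subsetsOfSize-uniform n k)))
  (All-map⁺ (subsetsOfSize-uniform n (suc k)))

subsetsOfSize-unique : ∀ n k → Unique (subsetsOfSize n k)
subsetsOfSize-unique n       zero    = [] ∷ []
subsetsOfSize-unique zero    (suc k) = []
subsetsOfSize-unique (suc n) (suc k) = Unique.++⁺
  (Unique.map⁺ ∷-injectiveʳ (subsetsOfSize-unique n k))
  (Unique.map⁺ ∷-injectiveʳ (subsetsOfSize-unique n (suc k)))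
  λ (p∈ , p∈′) → case ∈-map⁻ _ p∈ , ∈-map⁻ _ p∈′ of λ { ((_ , _ , refl) , (_ , _ , ())) }

someOfSize : k ≤ n → ∃ λ (p : Subset n) → ∣ p ∣ ≡ k
someOfSize {n = n} z≤n = ⊥ , ∣⊥∣≡0 n
someOfSize (s≤s k≤n) with someOfSize k≤n
... | p , ∣p∣≡k = inside ∷ p , cong suc ∣p∣≡k

x∈p⇒1+∣p[x]≔outside∣≡∣p∣ : ∀ {x} {p : Subset n} → x ∈ p → suc ∣ p [ x ]≔ outside ∣ ≡ ∣ p ∣
x∈p⇒1+∣p[x]≔outside∣≡∣p∣ Vec.here                            = refl
x∈p⇒1+∣p[x]≔outside∣≡∣p∣ {p = inside  ∷ p} (Vec.there x∈p) = cong suc (x∈p⇒1+∣p[x]≔outside∣≡∣p∣ x∈p)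
x∈p⇒1+∣p[x]≔outside∣≡∣p∣ {p = outside ∷ p} (Vec.there x∈p) = x∈p⇒1+∣p[x]≔outside∣≡∣p∣ x∈p

x∈p⇒p[x]≔outside[x]≔inside≡p : ∀ {x} {p : Subset n} → x ∈ p → (p [ x ]≔ outside) [ x ]≔ inside ≡ p
x∈p⇒p[x]≔outside[x]≔inside≡p {x = x} {p} x∈p = begin
  (p [ x ]≔ outside) [ x ]≔ inside ≡⟨ []≔-idempotent p x ⟩
  p [ x ]≔ inside                  ≡⟨ cong (p [ x ]≔_) ([]=⇒lookup x∈p) ⟨
  p [ x ]≔ lookup p x              ≡⟨ []≔-lookup p x ⟩
  p                                ∎
  where open ≡-Reasoning

-- The `j`-subsets range over the whole ground set and may already contain `x` or `y`. Repetitions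
-- and sets that are too small are harmless, since the list only serves as a cover, and its length
-- is simply `n C j`.
withPair : ℕ → Fin n → Fin n → List (Subset n)
withPair j x y = map (λ p → (p [ y ]≔ inside) [ x ]≔ inside) (subsetsOfSize _ j)

-- Deleting `x` and then `y` from `p` leaves a `k`-set, and inserting both again restores `p`. As
-- `y ≢ x`, the point `y` survives the first deletion, so each deletion lowers the size by one.
∈-withPair : ∀ {x y} {p : Subset n} → x ∈ p → y ∈ p → y ≢ x → ∣ p ∣ ≡ 2 + k → p ∈ˡ withPair k x y
∈-withPair {k = k} {x} {y} {p} x∈p y∈p y≢x ∣p∣≡2+k =
  subst (_∈ˡ withPair k x y) restored (∈-map⁺ _ (∈-subsetsOfSize⁺ q ∣q∣≡k))
  where
  q = (p [ x ]≔ outside) [ y ]≔ outside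

  y∈p[x]≔outside : y ∈ p [ x ]≔ outside
  y∈p[x]≔outside = []≔-minimal p y x y≢x y∈p

  ∣q∣≡k : ∣ q ∣ ≡ k
  ∣q∣≡k = suc-injective (suc-injective (begin
    2 + ∣ q ∣                 ≡⟨ cong suc (x∈p⇒1+∣p[x]≔outside∣≡∣p∣ y∈p[x]≔outside) ⟩
    1 + ∣ p [ x ]≔ outside ∣  ≡⟨ x∈p⇒1+∣p[x]≔outside∣≡∣p∣ x∈p ⟩
    ∣ p ∣                     ≡⟨ ∣p∣≡2+k ⟩
    2 + k                     ∎))
    where open ≡-Reasoning

  restored : (q [ y ]≔ inside) [ x ]≔ inside ≡ p
  restored = trans (cong (_[ x ]≔ inside) (x∈p⇒p[x]≔outside[x]≔inside≡p y∈p[x]≔outside))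
                   (x∈p⇒p[x]≔outside[x]≔inside≡p x∈p)

-- Growth of binomial coefficients

nCk≤n^k : ∀ n k → n C k ≤ n ^ k
nCk≤n^k n       zero    = ≤-refl
nCk≤n^k zero    (suc k) = z≤n
nCk≤n^k (suc n) (suc k) = begin
  suc n C suc k            ≡⟨ nCk+nC[k+1]≡[n+1]C[k+1] n k ⟨
  n C k + n C suc k        ≤⟨ +-mono-≤ (nCk≤n^k n k) (nCk≤n^k n (suc k)) ⟩
  n ^ k + n * n ^ k        ≤⟨ *-monoʳ-≤ (suc n) (^-monoˡ-≤ k (n≤1+n n)) ⟩
  suc n * suc n ^ k        ∎
  where open ≤-Reasoning

C-monoˡ-≤ : ∀ {m n} k → m ≤ n → m C k ≤ n C k
C-monoˡ-≤ zero    m≤n = ≤-refl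
C-monoˡ-≤ {zero} (suc k) m≤n = z≤n
C-monoˡ-≤ {suc m} {suc n} (suc k) (s≤s m≤n) =
  subst₂ _≤_ (nCk+nC[k+1]≡[n+1]C[k+1] m k) (nCk+nC[k+1]≡[n+1]C[k+1] n k)
    (+-mono-≤ (C-monoˡ-≤ k m≤n) (C-monoˡ-≤ (suc k) m≤n))

-- Raise the upper index from `m` to `i + m` in unit steps: by Pascal's rule and monotonicity, each
-- step adds at least `m C k`.
i*mCk≤[i+m]C[1+k] : ∀ i m k → i * (m C k) ≤ (i + m) C suc k
i*mCk≤[i+m]C[1+k] zero    m k = z≤n
i*mCk≤[i+m]C[1+k] (suc i) m k = begin
  m C k + i * (m C k)             ≤⟨ +-mono-≤ (C-monoˡ-≤ k (m≤n+m m i)) (i*mCk≤[i+m]C[1+k] i m k) ⟩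
  (i + m) C k + (i + m) C suc k   ≡⟨ nCk+nC[k+1]≡[n+1]C[k+1] (i + m) k ⟩
  suc (i + m) C suc k             ∎
  where open ≤-Reasoning

-- Combinatorially, split `k * q` points into `k` blocks of `q` points and choose one point from
-- each. The induction adds one block at a time.
q^k≤[k*q]Ck : ∀ q k → q ^ k ≤ (k * q) C k
q^k≤[k*q]Ck q zero    = ≤-refl
q^k≤[k*q]Ck q (suc k) = ≤-trans (*-monoʳ-≤ q (q^k≤[k*q]Ck q k)) (i*mCk≤[i+m]C[1+k] q (k * q) k)

-- The left side grows like the `k`-th power of `m`, the right side like the power `suc k`. With
-- `q = m / suc k`, the left is at most `c * b ^ k * q ^ k` and the right at least `q * q ^ k`, so
-- it suffices that `q` exceeds `c * b ^ k`.
C-growth : ∀ c a k → ∃ λ N → ∀ m → N ≤ m → c * ((a + m) C k) ≤ m C suc k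
-- Dividing this threshold by `suc k` gives exactly `suc (c * b ^ k)`, hence `c * b ^ k < q`.
C-growth c a k = suc (c * b ^ k) * suc k , bound
  where
  -- Once `q` is positive, `a` is at most `a * q`, and `m` is at most `(suc k + suc k) * q`: one
  -- `suc k` accounts for the quotient part, the other for the remainder.
  b = a + (suc k + suc k)

  bound : ∀ m → suc (c * b ^ k) * suc k ≤ m → c * ((a + m) C k) ≤ m C suc k
  bound m N≤m = begin
    c * ((a + m) C k)         ≤⟨ *-monoʳ-≤ c (nCk≤n^k (a + m) k) ⟩
    c * (a + m) ^ k           ≤⟨ *-monoʳ-≤ c (^-monoˡ-≤ k a+m≤b*q) ⟩
    c * (b * q) ^ k           ≡⟨ cong (c *_) (^-distribʳ-* k b q) ⟩
    c * (b ^ k * q ^ k)       ≡⟨ *-assoc c (b ^ k) (q ^ k) ⟨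
    c * b ^ k * q ^ k         ≤⟨ *-monoˡ-≤ (q ^ k) (<⇒≤ c*b^k<q) ⟩
    q * q ^ k                 ≤⟨ q^k≤[k*q]Ck q (suc k) ⟩
    (suc k * q) C suc k       ≤⟨ C-monoˡ-≤ (suc k) (subst (_≤ m) (*-comm q (suc k)) (m/n*n≤m m (suc k))) ⟩
    m C suc k                 ∎
    where
    open ≤-Reasoning
    q = m / suc k

    ^-distribʳ-* : ∀ k x y → (x * y) ^ k ≡ x ^ k * y ^ k
    ^-distribʳ-* zero    x y = refl
    ^-distribʳ-* (suc k) x y =
      trans (cong (x * y *_) (^-distribʳ-* k x y)) ([m*n]*[o*p]≡[m*o]*[n*p] x y (x ^ k) (y ^ k))

    c*b^k<q : c * b ^ k < q
    c*b^k<q = subst (_≤ q) (m*n/n≡m (suc (c * b ^ k)) (suc k)) (/-monoˡ-≤ (suc k) N≤m)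

    instance
      q≢0 : NonZero q
      q≢0 = >-nonZero (m<n⇒0<n c*b^k<q)

    a+m≤b*q : a + m ≤ b * q
    a+m≤b*q = begin
      a + m                              ≡⟨ cong (a +_) (m≡m%n+[m/n]*n m (suc k)) ⟩
      a + (m % suc k + q * suc k)        ≤⟨ +-monoʳ-≤ a (+-monoˡ-≤ (q * suc k) (<⇒≤ (m%n<n m (suc k)))) ⟩
      a + (suc k + q * suc k)            ≤⟨ +-mono-≤ (m≤m*n a q) (+-monoˡ-≤ (q * suc k) (m≤m*n (suc k) q)) ⟩
      a * q + (suc k * q + q * suc k)    ≡⟨ cong (λ x → a * q + (suc k * q + x)) (*-comm q (suc k)) ⟩
      a * q + (suc k * q + suc k * q)    ≡⟨ cong (a * q +_) (*-distribʳ-+ q (suc k) (suc k)) ⟨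
      a * q + (suc k + suc k) * q        ≡⟨ *-distribʳ-+ q a (suc k + suc k) ⟨
      b * q                              ∎

-- Existence of maxima

-- A downward search from the bound `b`. It must succeed by the time it reaches zero, since the
-- known witness is then itself zero.
maximum : ∀ {P : ℕ → Set} → Decidable P → ∀ b → (∀ m → P m → m ≤ b) → ∃ P → ∃ (IsMaximum P)
maximum P? b P≤b (a , Pa) with P? b
... | yes Pb = b , Pb , P≤b
maximum {P} P? zero    P≤b (a , Pa) | no ¬Pb = contradiction (subst P (n≤0⇒n≡0 (P≤b a Pa)) Pa) ¬Pb
maximum {P} P? (suc b) P≤b a,Pa     | no ¬Pb = maximum P? b P≤b′ a,Pa
  where
  P≤b′ : ∀ m → P m → m ≤ b
  P≤b′ m Pm = s≤s⁻¹ (≤∧≢⇒< (P≤b m Pm) λ { refl → ¬Pb Pm })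

anyVec? : ∀ m {P : Vec (Subset n) m → Set} → Decidable P → Dec (∃ P)
anyVec? zero    P? = map′ ([] ,_) (λ { ([] , P[]) → P[] }) (P? [])
anyVec? (suc m) P? = map′ (λ (x , xs , Pxs) → x ∷ xs , Pxs) (λ { (x ∷ xs , Pxs) → x , xs , Pxs })
  (anySubset? λ x → anyVec? m λ xs → P? (x ∷ xs))

-- A family of size `m` is found by a finite search through vectors of `m` subsets. `Q` speaks of
-- the list of members alone, so it transfers between vector and family whatever proofs the record
-- carries.
anyFamily? : {Q : List (Subset n) → Set} → Decidable Q → ∀ m →
             Dec (∃ λ (F : Family n k) → Q (members F) × size F ≡ m)
anyFamily? {n} {k} {Q} Q? m =
  map′ to from (anyVec? m λ v → IsFamily? (toList v) ×-dec Q? (toList v))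
  where
  IsFamily : List (Subset n) → Set
  IsFamily ps = Unique ps × All (λ p → ∣ p ∣ ≡ k) ps

  IsFamily? : Decidable IsFamily
  IsFamily? ps = unique? _≟_ ps ×-dec All.all? (λ p → ∣ p ∣ ≟ⁿ k) ps

  to : (∃ λ (v : Vec (Subset n) m) → IsFamily (toList v) × Q (toList v)) →
       ∃ λ (F : Family n k) → Q (members F) × size F ≡ m
  to (v , (v! , ∣v∣≡k) , Qv) =
    record { members = toList v ; distinct = v! ; uniform = ∣v∣≡k } , Qv , length-toList v

  from : (∃ λ (F : Family n k) → Q (members F) × size F ≡ m) →
         ∃ λ (v : Vec (Subset n) m) → IsFamily (toList v) × Q (toList v)
  from (F , QF , refl) =
    fromList (members F) ,
    subst (λ ps → IsFamily ps × Q ps) (sym (toList∘fromList (members F)))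
          ((distinct F , uniform F) , QF)

size≤nCk : ∀ (F : Family n k) → size F ≤ n C k
size≤nCk {n} {k} F = subst (size F ≤_) (length-subsetsOfSize n k)
  (Unique-⊆⇒length≤ (distinct F) λ A∈F → ∈-subsetsOfSize⁺ _ (All.lookup (uniform F) A∈F))

maximum-size : {P : Family n k → Set} →
               (∀ m → Dec (∃ λ F → P F × size F ≡ m)) → ∃ P → ∃ (IsMaxSize P)
maximum-size {n} {k} P? (F , PF) =
  maximum P? (n C k) (λ { _ (F , _ , refl) → size≤nCk F }) (size F , F , PF , refl)

Empty? : Decidable (Empty {n})
Empty? p = ¬? (nonempty? p)

-- A cluster has exactly `d` members, so the quantifier over all families reduces to a finite search
-- among those of size `d`.
clusterFree? : ∀ {n} k d (ps : List (Subset n)) →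
               Dec ((G : Family n k) → members G ⊆ˡ ps → ¬ IsCluster d G)
clusterFree? {n} k d ps = decide (anyFamily? Q? d)
  where
  Q : List (Subset n) → Set
  Q qs = qs ⊆ˡ ps × ∣ ⋃ qs ∣ ≤ 2 * k × Empty (⋂ qs)

  Q? : Decidable Q
  Q? qs = ⊆ˡ-dec _≟_ qs ps ×-dec (∣ ⋃ qs ∣ ≤? 2 * k) ×-dec Empty? (⋂ qs)

  decide : Dec (∃ λ (G : Family n k) → Q (members G) × size G ≡ d) →
           Dec ((G : Family n k) → members G ⊆ˡ ps → ¬ IsCluster d G)
  decide (yes (G , (G⊆ps , small , ⋂G≡∅) , ∣G∣≡d)) =
    no λ free → free G G⊆ps (∣G∣≡d , small , ⋂G≡∅)
  decide (no ∄G) =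
    yes λ G G⊆ps (∣G∣≡d , small , ⋂G≡∅) → ∄G (G , (G⊆ps , small , ⋂G≡∅) , ∣G∣≡d)

-- Families with two disjoint members

HasDisjointPair : List (Subset n) → Set
HasDisjointPair ps = Any (λ A → Any (λ B → Empty (A ∩ B)) ps) ps

hasDisjointPair? : Decidable (HasDisjointPair {n})
hasDisjointPair? ps = Any.any? (λ A → Any.any? (λ B → Empty? (A ∩ B)) ps) ps

-- A matching number has to be exhibited as an attained maximum, which the search over matchings
-- provides. The disjoint pair competes in it with size 2. Its sets differ because a set of positive
-- size is not disjoint from itself.
HasDisjointPair⇒1<ν : (F : Family n (suc k)) → HasDisjointPair (members F) →
                      ∃ λ ν → IsMatchingNumber F ν × 1 < ν
HasDisjointPair⇒1<ν {n} {k} F pair with find pair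
... | A , A∈F , pairA with find pairA
... | B , B∈F , A∩B≡∅ =
  case maximum-size matchingOfSize? (AB , AB-matching) of λ
    { (ν , isMax@(_ , ≤ν)) → ν , isMax , ≤ν 2 (AB , AB-matching , refl) }
  where
  matchingOfSize? : ∀ m → Dec (∃ λ M → (M ⊆ᶠ F × PairwiseDisjoint M) × size M ≡ m)
  matchingOfSize? = anyFamily? λ ps →
    ⊆ˡ-dec _≟_ ps (members F) ×-dec AllPairs.allPairs? (λ P Q → Empty? (P ∩ Q)) ps

  ∣A∣≡1+k : ∣ A ∣ ≡ suc k
  ∣A∣≡1+k = All.lookup (uniform F) A∈F

  A≢B : A ≢ B
  A≢B refl = 0≢1+n (begin
    0          ≡⟨ ∣⊥∣≡0 n ⟨
    ∣ ⊥ {n} ∣  ≡⟨ cong ∣_∣ (Empty-unique (subst Empty (∩-idem A) A∩B≡∅)) ⟨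
    ∣ A ∣      ≡⟨ ∣A∣≡1+k ⟩
    suc k      ∎)
    where open ≡-Reasoning

  AB : Family n (suc k)
  AB = record
    { members  = A ∷ B ∷ []
    ; distinct = (A≢B ∷ []) ∷ [] ∷ []
    ; uniform  = ∣A∣≡1+k ∷ All.lookup (uniform F) B∈F ∷ []
    }

  AB-matching : AB ⊆ᶠ F × PairwiseDisjoint AB
  AB-matching = (λ { (here refl) → A∈F ; (there (here refl)) → B∈F }) , (A∩B≡∅ ∷ []) ∷ [] ∷ []

1<ν⇒HasDisjointPair : (F : Family n k) → (∃ λ ν → IsMatchingNumber F ν × 1 < ν) →
                      HasDisjointPair (members F)
1<ν⇒HasDisjointPair F (_ , ((M , (M⊆F , disjoint) , refl) , _) , 1<ν) =
  pair (members M) M⊆F disjoint 1<ν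
  where
  pair : ∀ ps → ps ⊆ˡ members F → AllPairs (λ A B → Empty (A ∩ B)) ps → 1 < length ps →
         HasDisjointPair (members F)
  pair (A ∷ [])     _    _                   (s≤s ())
  pair (A ∷ B ∷ ps) ps⊆F ((A∩B≡∅ ∷ _) ∷ _) _ =
    lose (ps⊆F (here refl)) (lose (ps⊆F (there (here refl))) A∩B≡∅)

HasDisjointPair⇒NotWiseIntersecting : 2 ≤ t → (F : Family n k) → HasDisjointPair (members F) →
                                      NotWiseIntersecting t F
HasDisjointPair⇒NotWiseIntersecting {t = suc (suc t)} (s≤s (s≤s _)) F pair with find pair
... | A , A∈F , pairA with find pairA
... | B , B∈F , A∩B≡∅ =
  A ∷ B ∷ replicate t B , A∈F ∷ B∈F ∷ repeated t , λ (x , x∈⋂) →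
    let x∈A , x∈⋂′ = x∈p∩q⁻ A _ x∈⋂
    in A∩B≡∅ (x , x∈p∩q⁺ (x∈A , proj₁ (x∈p∩q⁻ B _ x∈⋂′)))
  where
  repeated : ∀ t → All (_∈ˡ members F) (toList (replicate t B))
  repeated zero    = []
  repeated (suc t) = B∈F ∷ repeated t

-- One factor `2 + k` counts the choices of `x` in `A₁`, the other those of `y` in the set
-- `missing x`; `n C k` bounds the ways to fill up the remaining `k` points.
¬HasDisjointPair⇒size≤ : 2 ≤ t → (F : Family n (2 + k)) → NotWiseIntersecting t F →
                         ¬ HasDisjointPair (members F) →
                         size F ≤ (2 + k) * ((2 + k) * (n C k))
¬HasDisjointPair⇒size≤ {n = n} {k} (s≤s _) F (A₁ ∷ As , A₁∈F ∷ As⊆F , ⋂≡∅) ¬pair = begin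
  size F                                        ≤⟨ Unique-⊆⇒length≤ (distinct F) ∈-cover ⟩
  length (concatMap cover (elements A₁))        ≤⟨ length-concatMap-≤ cover length-cover (elements A₁) ⟩
  length (elements A₁) * ((2 + k) * (n C k))    ≡⟨ cong (_* ((2 + k) * (n C k))) (length-elements-∈ A₁∈F) ⟩
  (2 + k) * ((2 + k) * (n C k))                 ∎
  where
  open ≤-Reasoning

  length-elements-∈ : ∀ {A} → A ∈ˡ members F → length (elements A) ≡ 2 + k
  length-elements-∈ {A} A∈F = trans (length-elements A) (All.lookup (uniform F) A∈F)

  meet : ∀ {A B} → A ∈ˡ members F → B ∈ˡ members F → Nonempty (A ∩ B)
  meet {A} {B} A∈F B∈F = decidable-stable (nonempty? (A ∩ B)) λ A∩B≡∅ → ¬pair (lose A∈F (lose B∈F A∩B≡∅))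

  -- The set is chosen from `x` alone, so the cover built from it is the same for every member of
  -- `F` through `x`.
  missing : ∀ x → ∃ λ A → A ∈ˡ toList (A₁ ∷ As) × x ∉ A
  missing = Empty⋂⇒∃∌ (toList (A₁ ∷ As)) ⋂≡∅

  missing∈F : ∀ x → proj₁ (missing x) ∈ˡ members F
  missing∈F x = All.lookup (A₁∈F ∷ As⊆F) (proj₁ (proj₂ (missing x)))

  cover : Fin n → List (Subset n)
  cover x = concatMap (withPair k x) (elements (proj₁ (missing x)))

  length-cover : ∀ x → length (cover x) ≤ (2 + k) * (n C k)
  length-cover x = begin
    length (cover x)
      ≤⟨ length-concatMap-≤ (withPair k x) (λ y → ≤-reflexive
           (trans (length-map _ (subsetsOfSize n k)) (length-subsetsOfSize n k)))
           (elements (proj₁ (missing x))) ⟩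
    length (elements (proj₁ (missing x))) * (n C k)
      ≡⟨ cong (_* (n C k)) (length-elements-∈ (missing∈F x)) ⟩
    (2 + k) * (n C k) ∎

  ∈-cover : members F ⊆ˡ concatMap cover (elements A₁)
  ∈-cover {A} A∈F with meet A∈F A₁∈F
  ... | x , x∈A∩A₁ with x∈p∩q⁻ A A₁ x∈A∩A₁ | meet A∈F (missing∈F x)
  ... | x∈A , x∈A₁ | y , y∈A∩A′ with x∈p∩q⁻ A (proj₁ (missing x)) y∈A∩A′
  -- The points `x` and `y` are distinct because `y` lies in a set that misses `x`.
  ... | y∈A , y∈A′ = ∈-concatMap⁺ _ (lose (∈-elements x∈A₁) (∈-concatMap⁺ _ (lose (∈-elements y∈A′)
    (∈-withPair x∈A y∈A (λ { refl → proj₂ (proj₂ (missing x)) y∈A′ }) (All.lookup (uniform F) A∈F)))))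

-- The extremal construction

-- Members through x always share x, while B together with two of the other
-- members already covers more than 2k points.
star∪disjoint-clusterFree : 3 ≤ d → (F : Family n k) (B : Subset n) (x : Fin n) → ∣ B ∣ ≡ k →
  (∀ {A} → A ∈ˡ members F → A ≢ B → x ∈ A × Empty (B ∩ A)) → ClusterFree d F
star∪disjoint-clusterFree {k = k} 3≤d F B x ∣B∣≡k star G G⊆F (refl , ∣⋃G∣≤2k , ⋂G≡∅)
  with ∈ˡ-dec _≟_ B (members G)
... | no  B∉G = ⋂G≡∅ (x , All∈⇒∈⋂ (All.tabulate λ A∈G →
  proj₁ (star (G⊆F A∈G) λ { refl → B∉G A∈G })))
... | yes B∈G with two-others _≟_ B (distinct G) 3≤d
... | P , Q , (P∈G , P≢B) , (Q∈G , Q≢B) , P≢Q = n≮n (2 * k) (begin-strict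
  2 * k              ≡⟨ cong (k +_) (+-identityʳ k) ⟩
  k + k              ≡⟨ cong₂ _+_ ∣B∣≡k ∣P∣≡k ⟨
  ∣ B ∣ + ∣ P ∣      <⟨ +-monoʳ-< ∣ B ∣ (∣p∣≡∣q∣∧p≢q⇒∣p∣<∣p∪q∣ (trans ∣P∣≡k (sym ∣Q∣≡k)) P≢Q) ⟩
  ∣ B ∣ + ∣ P ∪ Q ∣  ≡⟨ Empty[p∩q]⇒∣p∪q∣≡∣p∣+∣q∣ B (P ∪ Q) disjoint ⟨
  ∣ B ∪ (P ∪ Q) ∣    ≤⟨ p⊆q⇒∣p∣≤∣q∣ B∪P∪Q⊆⋃G ⟩
  ∣ ⋃ (members G) ∣  ≤⟨ ∣⋃G∣≤2k ⟩
  2 * k              ∎)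
  where
  open ≤-Reasoning

  ∣P∣≡k : ∣ P ∣ ≡ k
  ∣P∣≡k = All.lookup (uniform G) P∈G

  ∣Q∣≡k : ∣ Q ∣ ≡ k
  ∣Q∣≡k = All.lookup (uniform G) Q∈G

  disjoint : Empty (B ∩ (P ∪ Q))
  disjoint (y , y∈) with x∈p∩q⁻ B (P ∪ Q) y∈
  ... | y∈B , y∈P∪Q with x∈p∪q⁻ P Q y∈P∪Q
  ... | inj₁ y∈P = proj₂ (star (G⊆F P∈G) P≢B) (y , x∈p∩q⁺ (y∈B , y∈P))
  ... | inj₂ y∈Q = proj₂ (star (G⊆F Q∈G) Q≢B) (y , x∈p∩q⁺ (y∈B , y∈Q))

  B∪P∪Q⊆⋃G : B ∪ (P ∪ Q) ⊆ ⋃ (members G)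
  B∪P∪Q⊆⋃G y∈ with x∈p∪q⁻ B (P ∪ Q) y∈
  ... | inj₁ y∈B = p∈ps⇒p⊆⋃ps B∈G y∈B
  ... | inj₂ y∈P∪Q with x∈p∪q⁻ P Q y∈P∪Q
  ... | inj₁ y∈P = p∈ps⇒p⊆⋃ps P∈G y∈P
  ... | inj₂ y∈Q = p∈ps⇒p⊆⋃ps Q∈G y∈Q

-- The ground set splits into the point `zero`, a block of `suc k` points forming `B`, and `m` free
-- points. Every other member consists of `zero` and `k` free points; `k ≤ m` ensures that there is
-- one, and it is disjoint from `B`.
clusterFreeFamily : ∀ {m} → k ≤ m → 3 ≤ d → ∃ λ (F : Family (suc (suc k) + m) (suc k)) →
  (ClusterFree d F × HasDisjointPair (members F)) × m C k ≤ size F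
clusterFreeFamily {k = k} {m = m} k≤m 3≤d =
  F , (star∪disjoint-clusterFree 3≤d F B zero ∣B∣≡1+k star , pair) , mCk≤size
  where
  B : Subset (suc (suc k) + m)
  B = outside ∷ (⊤ {suc k} Vec.++ ⊥ {m})

  through₀ : Subset m → Subset (suc (suc k) + m)
  through₀ p = inside ∷ (⊥ {suc k} Vec.++ p)

  ∣B∣≡1+k : ∣ B ∣ ≡ suc k
  ∣B∣≡1+k = begin
    ∣ B ∣                        ≡⟨ ∣p++q∣≡∣p∣+∣q∣ (⊤ {suc k}) (⊥ {m}) ⟩
    ∣ ⊤ {suc k} ∣ + ∣ ⊥ {m} ∣    ≡⟨ cong₂ _+_ (∣⊤∣≡n (suc k)) (∣⊥∣≡0 m) ⟩
    suc k + 0                    ≡⟨ +-identityʳ (suc k) ⟩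
    suc k                        ∎
    where open ≡-Reasoning

  ∣through₀∣ : ∀ {p} → ∣ p ∣ ≡ k → ∣ through₀ p ∣ ≡ suc k
  ∣through₀∣ {p} ∣p∣≡k =
    cong suc (trans (∣p++q∣≡∣p∣+∣q∣ (⊥ {suc k}) p) (cong₂ _+_ (∣⊥∣≡0 (suc k)) ∣p∣≡k))

  ⊤++⊥-disjoint-⊥++ : ∀ l {p : Subset m} → Empty ((⊤ {l} Vec.++ ⊥ {m}) ∩ (⊥ {l} Vec.++ p))
  ⊤++⊥-disjoint-⊥++ zero {p} (x , x∈) = ∉⊥ (proj₁ (x∈p∩q⁻ ⊥ p x∈))
  ⊤++⊥-disjoint-⊥++ (suc l) (suc x , Vec.there x∈) = ⊤++⊥-disjoint-⊥++ l (x , x∈)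

  B∩through₀≡∅ : ∀ p → Empty (B ∩ through₀ p)
  B∩through₀≡∅ p (suc x , Vec.there x∈) = ⊤++⊥-disjoint-⊥++ (suc k) {p} (x , x∈)

  sets : List (Subset (suc (suc k) + m))
  sets = map through₀ (subsetsOfSize m k)

  F : Family (suc (suc k) + m) (suc k)
  F = record
    { members  = B ∷ sets
    -- `B` differs from every other member already at `zero`.
    ; distinct = All-map⁺ (All.tabulate λ _ ()) ∷
                 Unique.map⁺ (++-injectiveʳ (⊥ {suc k}) ⊥ ∘ ∷-injectiveʳ) (subsetsOfSize-unique m k)
    ; uniform  = ∣B∣≡1+k ∷ All-map⁺ (All.map ∣through₀∣ (subsetsOfSize-uniform m k))
    }

  star : ∀ {A} → A ∈ˡ B ∷ sets → A ≢ B → zero ∈ A × Empty (B ∩ A)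
  star (here A≡B) A≢B = contradiction A≡B A≢B
  star (there A∈) _ with ∈-map⁻ through₀ A∈
  ... | p , _ , refl = Vec.here , B∩through₀≡∅ p

  mCk≤size : m C k ≤ size F
  mCk≤size = begin
    m C k                         ≡⟨ length-subsetsOfSize m k ⟨
    length (subsetsOfSize m k)    ≡⟨ length-map through₀ (subsetsOfSize m k) ⟨
    length sets                   ≤⟨ n≤1+n (length sets) ⟩
    size F                        ∎
    where open ≤-Reasoning

  A : Subset (suc (suc k) + m)
  A = through₀ (proj₁ (someOfSize k≤m))

  A∈F : A ∈ˡ members F
  A∈F = there (∈-map⁺ through₀ (∈-subsetsOfSize⁺ _ (proj₂ (someOfSize k≤m))))

  pair : HasDisjointPair (members F)
  pair = here (lose A∈F (B∩through₀≡∅ _))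

g-and-f-agree : ∀ {j m} → 3 ≤ d → 2 ≤ t → suc j ≤ m → (2 + j) * ((2 + j) * ((3 + j + m) C j)) ≤ m C suc j →
      ∃ λ a → (g⟨ 3 + j + m , 2 + j , d , t ⟩≔ a) × (f⟨ 3 + j + m , 2 + j , d , 1 ⟩≔ a)
g-and-f-agree {d} {t} {j} {m} 3≤d 2≤t 1+j≤m few = optimum
  (maximum-size {P = λ F → ClusterFree d F × HasDisjointPair (members F)}
    sizeOfPaired? (F₀ , F₀-free , F₀-pair))
  where
  F₀-props = clusterFreeFamily 1+j≤m 3≤d
  F₀       = proj₁ F₀-props
  F₀-free  = proj₁ (proj₁ (proj₂ F₀-props))
  F₀-pair  = proj₂ (proj₁ (proj₂ F₀-props))

  sizeOfPaired? : ∀ a → Dec (∃ λ F → (ClusterFree d F × HasDisjointPair (members F)) × size F ≡ a)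
  sizeOfPaired? = anyFamily? λ ps → clusterFree? (2 + j) d ps ×-dec hasDisjointPair? ps

  optimum : ∃ (IsMaxSize λ F → ClusterFree d F × HasDisjointPair (members F)) →
            ∃ λ a → (g⟨ 3 + j + m , 2 + j , d , t ⟩≔ a) × (f⟨ 3 + j + m , 2 + j , d , 1 ⟩≔ a)
  -- The largest cluster-free family with a disjoint pair attains both maxima. For `f` the two
  -- conditions are equivalent; for `g` competitors without a disjoint pair remain, and `F₀` is at
  -- least as large as any of them.
  optimum (a , (F , (free , pair) , ∣F∣≡a) , ≤a) = a ,
    ((F , (free , HasDisjointPair⇒NotWiseIntersecting 2≤t F pair) , ∣F∣≡a) , g≤a) ,
    ((F , (free , HasDisjointPair⇒1<ν F pair) , ∣F∣≡a) ,
     λ { b (G , (G-free , 1<ν) , ∣G∣≡b) → ≤a b (G , (G-free , 1<ν⇒HasDisjointPair G 1<ν) , ∣G∣≡b) })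
    where
    g≤a : ∀ b → (∃ λ G → (ClusterFree d G × NotWiseIntersecting t G) × size G ≡ b) → b ≤ a
    g≤a b (G , (G-free , notInt) , refl) with hasDisjointPair? (members G)
    ... | yes pair′ = ≤a b (G , (G-free , pair′) , refl)
    ... | no ¬pair  = begin
      size G                                        ≤⟨ ¬HasDisjointPair⇒size≤ 2≤t G notInt ¬pair ⟩
      (2 + j) * ((2 + j) * ((3 + j + m) C j))       ≤⟨ few ⟩
      m C suc j                                     ≤⟨ proj₂ (proj₂ F₀-props) ⟩
      size F₀                                       ≤⟨ ≤a (size F₀) (F₀ , (F₀-free , F₀-pair) , refl) ⟩
      a                                             ∎
      where open ≤-Reasoning

theorem1p10 : ∀ (k d t : ℕ) → 3 ≤ d → d ≤ k → 2 ≤ t →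
    ∃ λ (N : ℕ) → ∀ (n : ℕ) → N ≤ n →
    ∃ λ (m : ℕ) → (g⟨ n , k , d , t ⟩≔ m) × (f⟨ n , k , d , 1 ⟩≔ m)
theorem1p10 k d t 3≤d d≤k 2≤t with ≤-trans 3≤d d≤k
-- Matching on `3 ≤ k` writes `k` as `2 + j`. The constant is k squared, and the shift `3 + j` turns
-- the `m` free points into the whole ground set.
... | s≤s (s≤s {n = j} _) with C-growth ((2 + j) * (2 + j)) (3 + j) j
-- Setting aside `3 + j` points for `zero` and `B` leaves `m` free points with `N + suc j ≤ m`,
-- which yields both `N ≤ m` for the growth estimate and `suc j ≤ m` for the construction.
... | N , growth = (3 + j) + (N + suc j) , equality
  where
  equality : ∀ n → (3 + j) + (N + suc j) ≤ n →
             ∃ λ m → (g⟨ n , 2 + j , d , t ⟩≔ m) × (f⟨ n , 2 + j , d , 1 ⟩≔ m)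
  equality n bound with m≤n⇒∃[o]m+o≡n (m+n≤o⇒m≤o (3 + j) bound)
  ... | m , refl = g-and-f-agree 3≤d 2≤t (m+n≤o⇒n≤o N N+1+j≤m)
    (subst (_≤ m C suc j) (*-assoc (2 + j) (2 + j) ((3 + j + m) C j))
      (growth m (m+n≤o⇒m≤o N N+1+j≤m)))
    where
    N+1+j≤m : N + suc j ≤ m
    N+1+j≤m = +-cancelˡ-≤ (3 + j) (N + suc j) m bound
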